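{- Let $G = C_{n_1}\square C_{n_2}\square\cdots\square C_{n_k}$ be the Cartesian product of $k$ cycles, where $k\geq 2$, $n_i\neq n_j$ for $i\neq j$, and $n_i\geq 5$ for all $i\in\{1,\dots,k\}$. Then $\rho'(G)=2$ and $\rho(G)=3$.
   Context: $C_n$ is the cycle on $n$ vertices and $\square$ is the Cartesian product of graphs. A vertex (or edge) coloring of a graph is distinguishing if no automorphism other than the identity preserves it. $D(G)$ (resp. $D'(G)$) is the least number of colors in a distinguishing vertex (resp. edge) coloring of $G$. When $D(G)=2$, the cost of distinguishing $\rho(G)$ is the minimum number of vertices in the smaller color class over all distinguishing vertex colorings of $G$ with two colors. When $D'(G)=2$, the cost of edge-distinguishing $\rho'(G)$ is the minimum number of edges in the smaller color class over all distinguishing edge colorings of $G$ with two colors. -}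

module Defs where

open import Data.Fin.Base using (Fin; zero; suc; toℕ)
open import Data.Fin.Properties as Fin using (1↔⊤; *↔×; eq?)
open import Data.Nat.Base using (ℕ; suc; _*_; _≤_; _⊓_)
open import Data.Nat.Properties as ℕ using ()
open import Data.Product.Base using (Σ-syntax; ∃; ∃₂; _×_; _,_; proj₁)
open import Data.Product.Function.NonDependent.Propositional using (_×-↔_)
open import Data.Sum.Base using (_⊎_; inj₁; inj₂; swap)
open import Data.Unit.Base using (⊤)
open import Data.Empty using (⊥)
open import Data.Vec.Functional using (Vector; foldr)
open import Function.Base using (_∘_)
open import Function.Bundles using (_↔_; Inverse; Func)
open import Function.Construct.Composition using (_↔-∘_)
open import Function.Construct.Identity using (↔-id)
open import Function.Construct.Symmetry using (↔-sym)
open import Function.Properties.Inverse using (Inverse⇒Injection)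
open import Level using (0ℓ)
open import Relation.Binary.Bundles using (Setoid)
open import Relation.Binary.Construct.On as On using ()
open import Relation.Binary.Core using (Rel)
open import Relation.Binary.Definitions using (Decidable; DecidableEquality; Symmetric)
open import Relation.Binary.PropositionalEquality as ≡ using (_≡_; _≢_; refl; sym; trans)
open import Relation.Nullary using (¬_; no)
open import Relation.Nullary.Decidable using (_×-dec_; _⊎-dec_; ¬?)

------------------------------------------------------------------------
-- Finite simple graphs

record Graph : Set₁ where
  infix 4 _~_ _~?_
  field
    Vertex   : Set
    order    : ℕ
    vertices : Vertex ↔ Fin order
    _~_      : Rel Vertex 0ℓ
    _~?_     : Decidable _~_
    ~-sym    : Symmetric _~_
    ~-irrefl : ∀ {v} → ¬ (v ~ v)

  infix 4 _≟_
  _≟_ : DecidableEquality Vertex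
  _≟_ = eq? (Inverse⇒Injection vertices)

K₁ : Graph
K₁ = record
  { Vertex   = ⊤
  ; order    = 1
  ; vertices = ↔-sym 1↔⊤
  ; _~_      = λ _ _ → ⊥
  ; _~?_     = λ _ _ → no λ ()
  ; ~-sym    = λ ()
  ; ~-irrefl = λ ()
  }

-- j follows i in the cyclic order 0, 1, …, n-1, 0.
Next : ∀ {n} → Rel (Fin n) 0ℓ
Next {n} i j = toℕ j ≡ suc (toℕ i) ⊎ (suc (toℕ i) ≡ n × toℕ j ≡ 0)

-- The condition i ≢ j only matters for n = 1, where it removes the loop.
C : ℕ → Graph
C n = record
  { Vertex   = Fin n
  ; order    = n
  ; vertices = ↔-id (Fin n)
  ; _~_      = λ i j → i ≢ j × (Next i j ⊎ Next j i)
  ; _~?_     = λ i j → ¬? (i Fin.≟ j) ×-dec (next? i j ⊎-dec next? j i)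
  ; ~-sym    = λ (i≢j , a) → i≢j ∘ sym , swap a
  ; ~-irrefl = λ (i≢i , _) → i≢i refl
  }
  where
  next? : Decidable (Next {n})
  next? i j = (toℕ j ℕ.≟ suc (toℕ i)) ⊎-dec ((suc (toℕ i) ℕ.≟ n) ×-dec (toℕ j ℕ.≟ 0))

infixr 7 _□_
_□_ : Graph → Graph → Graph
G □ H = record
  { Vertex   = G.Vertex × H.Vertex
  ; order    = G.order * H.order
  ; vertices = ↔-sym *↔× ↔-∘ (G.vertices ×-↔ H.vertices)
  ; _~_      = λ (g , h) (g′ , h′) → (g ≡ g′ × h H.~ h′) ⊎ (g G.~ g′ × h ≡ h′)
  ; _~?_     = λ (g , h) (g′ , h′) →
                 ((g G.≟ g′) ×-dec (h H.~? h′)) ⊎-dec ((g G.~? g′) ×-dec (h H.≟ h′))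
  ; ~-sym    = λ { (inj₁ (p , a)) → inj₁ (sym p , H.~-sym a)
                 ; (inj₂ (a , p)) → inj₂ (G.~-sym a , sym p) }
  ; ~-irrefl = λ { (inj₁ (_ , a)) → H.~-irrefl a
                 ; (inj₂ (a , _)) → G.~-irrefl a }
  }
  where
  module G = Graph G
  module H = Graph H

-- G₁ □ (G₂ □ (⋯ □ (Gₖ □ K₁))); K₁ is the unit of □ up to isomorphism.
□-product : ∀ {k} → Vector Graph k → Graph
□-product = foldr _□_ K₁

record Automorphism (G : Graph) : Set where
  open Graph G
  field
    perm      : Vertex ↔ Vertex
  open Inverse perm public using (to; from)
  field
    preserves : ∀ {u v} → u ~ v → to u ~ to v
    reflects  : ∀ {u v} → to u ~ to v → u ~ v

IsIdentity : ∀ {G} → Automorphism G → Set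
IsIdentity φ = ∀ v → Automorphism.to φ v ≡ v

------------------------------------------------------------------------
-- Vertices and edges, with the action of automorphisms

vertexSetoid : Graph → Setoid 0ℓ 0ℓ
vertexSetoid G = ≡.setoid (Graph.Vertex G)

-- The edge uv is represented by both (u , v) and (v , u), which are
-- identified; the adjacency proof is ignored.
edgeSetoid : Graph → Setoid 0ℓ 0ℓ
edgeSetoid G = record
  { Carrier       = Σ[ u ∈ Vertex ] Σ[ v ∈ Vertex ] u ~ v
  ; _≈_           = λ (u , v , _) (u′ , v′ , _) →
                      (u ≡ u′ × v ≡ v′) ⊎ (u ≡ v′ × v ≡ u′)
  ; isEquivalence = record
    { refl  = inj₁ (refl , refl)
    ; sym   = λ { (inj₁ (p , q)) → inj₁ (sym p , sym q)
                ; (inj₂ (p , q)) → inj₂ (sym q , sym p) }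
    ; trans = λ { (inj₁ (p , q)) (inj₁ (r , s)) → inj₁ (trans p r , trans q s)
                ; (inj₁ (p , q)) (inj₂ (r , s)) → inj₂ (trans p r , trans q s)
                ; (inj₂ (p , q)) (inj₁ (r , s)) → inj₂ (trans p s , trans q r)
                ; (inj₂ (p , q)) (inj₂ (r , s)) → inj₁ (trans p s , trans q r) }
    }
  }
  where open Graph G

actV : ∀ {G} → Automorphism G → Setoid.Carrier (vertexSetoid G) → Setoid.Carrier (vertexSetoid G)
actV = Automorphism.to

actE : ∀ {G} → Automorphism G → Setoid.Carrier (edgeSetoid G) → Setoid.Carrier (edgeSetoid G)
actE φ (u , v , u~v) = to u , to v , preserves u~v
  where open Automorphism φ

------------------------------------------------------------------------
-- Distinguishing colorings and their cost

IsLeast : (ℕ → Set) → ℕ → Set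
IsLeast P m = P m × (∀ m′ → P m′ → m ≤ m′)

HasSize : Setoid 0ℓ 0ℓ → ℕ → Set
HasSize X m = Inverse X (≡.setoid (Fin m))

-- X is the set being colored: the vertices or the edges of G.
module Distinguish (G : Graph) (X : Setoid 0ℓ 0ℓ)
                   (act : Automorphism G → Setoid.Carrier X → Setoid.Carrier X) where

  Coloring : ℕ → Set
  Coloring d = Func X (≡.setoid (Fin d))

  Preserves : ∀ {d} → Automorphism G → Coloring d → Set
  Preserves φ c = ∀ x → Func.to c (act φ x) ≡ Func.to c x

  Distinguishing : ∀ {d} → Coloring d → Set
  Distinguishing c = ∀ φ → Preserves φ c → IsIdentity φ

  Number≡ : ℕ → Set
  Number≡ = IsLeast (λ d → ∃ λ (c : Coloring d) → Distinguishing c)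

  colorClass : ∀ {d} → Coloring d → Fin d → Setoid 0ℓ 0ℓ
  colorClass c j = On.setoid {B = ∃ λ x → Func.to c x ≡ j} X proj₁

  SmallerClassSize : Coloring 2 → ℕ → Set
  SmallerClassSize c m = ∃₂ λ a b →
    HasSize (colorClass c zero) a × HasSize (colorClass c (suc zero)) b × m ≡ a ⊓ b

  -- The cost is defined only when two is the least number of colors.
  Cost≡ : ℕ → Set
  Cost≡ m = Number≡ 2 ×
    IsLeast (λ s → ∃ λ (c : Coloring 2) → Distinguishing c × SmallerClassSize c s) m

module _ (G : Graph) where
  open Distinguish G (vertexSetoid G) actV public
    using () renaming (Number≡ to D≡; Cost≡ to ρ≡)
  open Distinguish G (edgeSetoid G) actE public
    using () renaming (Number≡ to D′≡; Cost≡ to ρ′≡)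

{-# OPTIONS --safe #-}
module Submission where

-- Since all nᵢ ≥ 5, the vertices u + eᵢ and u − eᵢ have u as their only common
-- neighbour, whereas u ± eᵢ and u ± eⱼ (i ≠ j) lie on a 4-cycle through u.  Hence
-- an automorphism maps straight walks to straight walks, and as the nᵢ are the
-- distinct lengths after which these close up, it preserves directions.  So it
-- acts on each coordinate separately, and is the identity as soon as for each i it
-- fixes two vertices whose i-th coordinates are consecutive.
--
-- Upper bounds: with a = 0 and d = e₂ + e₃ + ⋯, an automorphism preserving the set
-- {a, a + e₁, d + e₀} of vertices, or the set {{a, a + e₀}, {d, d + e₁}} of edges,
-- fixes each of the vertices involved.  Lower bounds: x ↦ u + v − x is a nontrivial
-- automorphism swapping u and v, so a vertex class with at most two elements or an
-- edge class with at most one element is preserved by such a reflection.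

open import Defs
open import Data.Bool.Base using (Bool; true; false; not)
open import Data.Bool.Properties using (¬-not; not-involutive) renaming (_≟_ to _≟ᵇ_)
open import Data.Fin using (Fin; zero; suc; toℕ; fromℕ<)
open import Data.Fin.Properties as Fin using (toℕ-injective; toℕ-fromℕ<; toℕ<n)
open import Data.List.Base as List
  using (List; []; _∷_; length; filter; deduplicate; mapMaybe; cartesianProduct; tabulate)
import Data.List.Membership.DecSetoid as DecMembership
open import Data.List.Membership.Propositional.Properties using (∈-tabulate⁺; ∈-cartesianProduct⁺)
import Data.List.Membership.Setoid as Membership
open import Data.List.Membership.Setoid.Properties
  using (∈-resp-≈; ∈-lookup; ∈-filter⁺; ∈-filter⁻)
open import Data.List.Relation.Unary.All as All using ([]; _∷_)
open import Data.List.Relation.Unary.AllPairs using ([]; _∷_)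
open import Data.List.Relation.Unary.Any as Any using (Any; here; there; index)
open import Data.List.Relation.Unary.Any.Properties using (lookup-index; mapMaybe⁺; map⁺)
open import Data.List.Relation.Unary.Enumerates.Setoid using (IsEnumeration)
open import Data.List.Relation.Unary.Enumerates.Setoid.Properties using (deduplicate⁺)
open import Data.List.Relation.Unary.Unique.DecSetoid.Properties using (deduplicate-!)
open import Data.List.Relation.Unary.Unique.Setoid using (Unique)
open import Data.List.Relation.Unary.Unique.Setoid.Properties using (filter⁺)
open import Data.Maybe.Base using (Maybe; just; nothing)
import Data.Maybe.Relation.Unary.Any as Maybe
open import Data.Nat using (ℕ; zero; suc; _+_; _∸_; _*_; _≤_; _<_; z≤n; s≤s)
open import Data.Nat.DivMod
  using ( _/_; _%_; _mod_; %-distribˡ-+; m%n%n≡m%n; m%n<n; m<n⇒m%n≡m; [m+n]%n≡m%n; n%n≡0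
        ; m≡m%n+[m/n]*n)
open import Data.Nat.GeneralisedArithmetic using (fold)
import Data.Nat.Properties as ℕ
open import Data.Product using (∃; ∃₂; _×_; _,_; proj₁; proj₂)
open import Data.Sum using (_⊎_; inj₁; inj₂)
open import Data.Unit using (tt)
open import Function.Base using (_∘_)
open import Function.Bundles using (Func; Inverse; mk↔ₛ′)
open import Level using (0ℓ)
open import Relation.Binary.Bundles using (Setoid; DecSetoid)
import Relation.Binary.Construct.On as On
open import Relation.Binary.PropositionalEquality
  using (_≡_; _≢_; refl; sym; trans; cong; cong₂; subst; subst₂; module ≡-Reasoning)
open import Relation.Nullary using (¬_; contradiction; yes; no)
open import Relation.Nullary.Decidable using (_×-dec_; _⊎-dec_)
open import Relation.Unary using (_⊆_)

-- Rotations and reflections of a cycle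

shift : ∀ {m} → ℕ → Fin m → Fin m
shift {suc _} a x = (toℕ x + a) mod suc _

-- `true` stands for +1 and `false` for -1; the latter is encoded as a shift by m - 1, so that both
-- directions are shifts by natural numbers.
rotate : ∀ {m} → Bool → Fin m → Fin m
rotate true          = shift 1
rotate {m} false     = shift (m ∸ 1)

module _ {m : ℕ} where

  toℕ-shift : ∀ a (x : Fin (suc m)) → toℕ (shift a x) ≡ (toℕ x + a) % suc m
  toℕ-shift a x = toℕ-fromℕ< (m%n<n (toℕ x + a) (suc m))

  %-+ˡ : ∀ a b → (a % suc m + b) % suc m ≡ (a + b) % suc m
  %-+ˡ a b = begin
    (a % suc m + b) % suc m                 ≡⟨ %-distribˡ-+ (a % suc m) b (suc m) ⟩
    (a % suc m % suc m + b % suc m) % suc m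
      ≡⟨ cong (λ c → (c + b % suc m) % suc m) (m%n%n≡m%n a (suc m)) ⟩
    (a % suc m + b % suc m) % suc m         ≡⟨ %-distribˡ-+ a b (suc m) ⟨
    (a + b) % suc m                         ∎
    where open ≡-Reasoning

shift-shift : ∀ {m} a b (x : Fin m) → shift b (shift a x) ≡ shift (a + b) x
shift-shift {suc m} a b x = toℕ-injective (begin
  toℕ (shift b (shift a x))             ≡⟨ toℕ-shift b (shift a x) ⟩
  (toℕ (shift a x) + b) % suc m         ≡⟨ cong (λ c → (c + b) % suc m) (toℕ-shift a x) ⟩
  ((toℕ x + a) % suc m + b) % suc m     ≡⟨ %-+ˡ (toℕ x + a) b ⟩
  (toℕ x + a + b) % suc m               ≡⟨ cong (_% suc m) (ℕ.+-assoc (toℕ x) a b) ⟩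
  (toℕ x + (a + b)) % suc m             ≡⟨ toℕ-shift (a + b) x ⟨
  toℕ (shift (a + b) x)                 ∎)
  where open ≡-Reasoning

shift-0 : ∀ {m} (x : Fin m) → shift 0 x ≡ x
shift-0 {suc m} x = toℕ-injective
  (trans (toℕ-shift 0 x) (trans (cong (_% suc m) (ℕ.+-identityʳ (toℕ x))) (m<n⇒m%n≡m (toℕ<n x))))

shift-order : ∀ {m} (x : Fin m) → shift m x ≡ x
shift-order {suc m} x = toℕ-injective
  (trans (toℕ-shift (suc m) x) (trans ([m+n]%n≡m%n (toℕ x) (suc m)) (m<n⇒m%n≡m (toℕ<n x))))

-- Dividing x + (a + 1) by m leaves remainder x, so a + 1 is a multiple of m; being positive, it is
-- at least m.
shift-fixed : ∀ {m} a (x : Fin m) → shift (suc a) x ≡ x → m ≤ suc a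
shift-fixed {suc m} a x fixed = go (t / suc m) (ℕ.+-cancelˡ-≡ (toℕ x) _ _
  (trans (m≡m%n+[m/n]*n t (suc m)) (cong (_+ (t / suc m) * suc m)
    (trans (sym (toℕ-shift (suc a) x)) (cong toℕ fixed)))))
  where
  t = toℕ x + suc a
  go : ∀ q → suc a ≡ q * suc m → suc m ≤ suc a
  go (suc q) eq = subst (suc m ≤_) (sym eq) (ℕ.m≤m+n (suc m) _)

rotate-cancel : ∀ {m} s (x : Fin m) → rotate s (rotate (not s) x) ≡ x
rotate-cancel {suc m} true  x = trans (shift-shift m 1 x)
  (trans (cong (λ a → shift a x) (ℕ.+-comm m 1)) (shift-order x))
rotate-cancel {suc m} false x = trans (shift-shift 1 m x) (shift-order x)

rotate-cancel′ : ∀ {m} s (x : Fin m) → rotate (not s) (rotate s x) ≡ x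
rotate-cancel′ true  = rotate-cancel false
rotate-cancel′ false = rotate-cancel true

fold-shift : ∀ {m} a (x : Fin m) → fold x (shift 1) a ≡ shift a x
fold-shift zero    x = sym (shift-0 x)
fold-shift (suc a) x = trans (cong (shift 1) (fold-shift a x))
  (trans (shift-shift a 1 x) (cong (λ b → shift b x) (ℕ.+-comm a 1)))

fold-suc : ∀ {A : Set} (f : A → A) x a → f (fold x f a) ≡ fold (f x) f a
fold-suc f x zero    = refl
fold-suc f x (suc a) = cong f (fold-suc f x a)

fold-rotate-cancel : ∀ {m} (x : Fin m) a → fold (fold x (rotate false) a) (rotate true) a ≡ x
fold-rotate-cancel x zero    = refl
fold-rotate-cancel x (suc a) = trans (fold-suc (rotate true) _ a)
  (trans (cong (λ y → fold y (rotate true) a) (rotate-cancel true _)) (fold-rotate-cancel x a))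

rotate-order : ∀ {m} s (x : Fin m) → fold x (rotate s) m ≡ x
rotate-order {m} true  x = trans (fold-shift m x) (shift-order x)
rotate-order {m} false x = trans (sym (rotate-order true _)) (fold-rotate-cancel x m)

-- The forward walk retraces a backward walk of the same length, so a closed backward walk yields a
-- closed forward one.
rotate-period : ∀ {m} s (x : Fin m) a → fold x (rotate s) (suc a) ≡ x → m ≤ suc a
rotate-period true  x a fixed = shift-fixed a x (trans (sym (fold-shift (suc a) x)) fixed)
rotate-period false x a fixed = rotate-period true x a
  (trans (cong (λ y → fold y (rotate true) (suc a)) (sym fixed)) (fold-rotate-cancel x (suc a)))

fold-rotate-transitive : ∀ {m} (x y : Fin m) → ∃ λ a → y ≡ fold x (rotate true) a
fold-rotate-transitive {suc m} x y = a , toℕ-injective (sym (begin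
  toℕ (fold x (rotate true) a)             ≡⟨ cong toℕ (fold-shift a x) ⟩
  toℕ (shift a x)                          ≡⟨ toℕ-shift a x ⟩
  (toℕ x + (suc m ∸ toℕ x + toℕ y)) % suc m ≡⟨ cong (_% suc m) (ℕ.+-assoc (toℕ x) _ _) ⟨
  (toℕ x + (suc m ∸ toℕ x) + toℕ y) % suc m
    ≡⟨ cong (λ b → (b + toℕ y) % suc m) (ℕ.m+[n∸m]≡n (ℕ.<⇒≤ (toℕ<n x))) ⟩
  (suc m + toℕ y) % suc m                  ≡⟨ cong (_% suc m) (ℕ.+-comm (suc m) (toℕ y)) ⟩
  (toℕ y + suc m) % suc m                  ≡⟨ [m+n]%n≡m%n (toℕ y) (suc m) ⟩
  toℕ y % suc m                            ≡⟨ m<n⇒m%n≡m (toℕ<n y) ⟩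
  toℕ y                                    ∎))
  where
  open ≡-Reasoning
  -- The residue y - x, with the modulus added first so that the truncated subtraction is exact.
  a = suc m ∸ toℕ x + toℕ y

rotate-moves : ∀ {m} → 5 ≤ m → ∀ s (x : Fin m) → rotate s x ≢ x
rotate-moves 5≤m s x eq with ℕ.≤-trans 5≤m (rotate-period s x 0 eq)
... | s≤s ()

rotate²-moves : ∀ {m} → 5 ≤ m → ∀ s (x : Fin m) → rotate s (rotate s x) ≢ x
rotate²-moves 5≤m s x eq with ℕ.≤-trans 5≤m (rotate-period s x 1 eq)
... | s≤s (s≤s ())

-- The bound 5 is sharp here: on a cycle with four vertices this walk closes up.
rotate⁴-moves : ∀ {m} → 5 ≤ m → ∀ s (x : Fin m) →
  rotate s (rotate s (rotate s (rotate s x))) ≢ x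
rotate⁴-moves 5≤m s x eq with ℕ.≤-trans 5≤m (rotate-period s x 3 eq)
... | s≤s (s≤s (s≤s (s≤s ())))

rotate-opposite : ∀ {m} → 5 ≤ m → ∀ s (x : Fin m) → rotate s x ≢ rotate (not s) x
rotate-opposite 5≤m s x eq =
  rotate²-moves 5≤m s x (trans (cong (rotate s) eq) (rotate-cancel s x))

Next⇒rotate : ∀ {m} {x y : Fin m} → Next x y → y ≡ rotate true x
Next⇒rotate {suc m} {x} {y} (inj₁ eq) = toℕ-injective (sym (begin
  toℕ (shift 1 x)       ≡⟨ toℕ-shift 1 x ⟩
  (toℕ x + 1) % suc m   ≡⟨ cong (_% suc m) (trans (ℕ.+-comm (toℕ x) 1) (sym eq)) ⟩
  toℕ y % suc m         ≡⟨ m<n⇒m%n≡m (toℕ<n y) ⟩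
  toℕ y                 ∎))
  where open ≡-Reasoning
Next⇒rotate {suc m} {x} {y} (inj₂ (last , y≡0)) = toℕ-injective (trans y≡0 (sym (begin
  toℕ (shift 1 x)       ≡⟨ toℕ-shift 1 x ⟩
  (toℕ x + 1) % suc m   ≡⟨ cong (_% suc m) (trans (ℕ.+-comm (toℕ x) 1) last) ⟩
  suc m % suc m         ≡⟨ n%n≡0 (suc m) ⟩
  0                     ∎)))
  where open ≡-Reasoning

rotate⇒Next : ∀ {m} (x : Fin m) → Next x (rotate true x)
rotate⇒Next {suc m} x with suc (toℕ x) ℕ.<? suc m
... | yes x+1<m = inj₁ (trans (toℕ-shift 1 x)
  (trans (cong (_% suc m) (ℕ.+-comm (toℕ x) 1)) (m<n⇒m%n≡m x+1<m)))
... | no  x+1≮m = inj₂ (last , trans (toℕ-shift 1 x)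
  (trans (cong (_% suc m) (trans (ℕ.+-comm (toℕ x) 1) last)) (n%n≡0 (suc m))))
  where last = ℕ.≤-antisym (toℕ<n x) (ℕ.≮⇒≥ x+1≮m)

adjacent⇒rotate : ∀ {m} {x y : Fin m} → Graph._~_ (C m) x y → ∃ λ s → y ≡ rotate s x
adjacent⇒rotate (_ , inj₁ next) = true  , Next⇒rotate next
adjacent⇒rotate (_ , inj₂ next) = false ,
  trans (sym (rotate-cancel′ true _)) (cong (rotate false) (sym (Next⇒rotate next)))

rotate-adjacent : ∀ {m} → 5 ≤ m → ∀ s (x : Fin m) → Graph._~_ (C m) x (rotate s x)
rotate-adjacent 5≤m true  x = rotate-moves 5≤m true x ∘ sym , inj₁ (rotate⇒Next x)
rotate-adjacent 5≤m false x = rotate-moves 5≤m false x ∘ sym ,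
  inj₂ (subst (Next (rotate false x)) (rotate-cancel true x) (rotate⇒Next (rotate false x)))

-- The map x ↦ u + v - x modulo m, which swaps u and v.
reflect : ∀ {m} → Fin m → Fin m → Fin m → Fin m
reflect {suc m} u v x = (toℕ u + toℕ v + (suc m ∸ toℕ x)) mod suc m

module _ {m : ℕ} where

  +-cancelʳ-% : ∀ a b (x : Fin (suc m)) →
    (a + toℕ x) % suc m ≡ (b + toℕ x) % suc m → a % suc m ≡ b % suc m
  +-cancelʳ-% a b x eq = begin
    a % suc m                              ≡⟨ lemma a ⟨
    ((a + toℕ x) % suc m + x′) % suc m     ≡⟨ cong (λ c → (c + x′) % suc m) eq ⟩
    ((b + toℕ x) % suc m + x′) % suc m     ≡⟨ lemma b ⟩
    b % suc m                              ∎
    where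
    open ≡-Reasoning
    x′ = suc m ∸ toℕ x
    lemma : ∀ c → ((c + toℕ x) % suc m + x′) % suc m ≡ c % suc m
    lemma c = trans (%-+ˡ (c + toℕ x) x′) (trans (cong (_% suc m) (trans (ℕ.+-assoc c (toℕ x) x′)
      (cong (c +_) (ℕ.m+[n∸m]≡n (ℕ.<⇒≤ (toℕ<n x)))))) ([m+n]%n≡m%n c (suc m)))

  reflect-sum : ∀ u v (x : Fin (suc m)) →
    (toℕ (reflect u v x) + toℕ x) % suc m ≡ (toℕ u + toℕ v) % suc m
  reflect-sum u v x = begin
    (toℕ (reflect u v x) + toℕ x) % suc m
      ≡⟨ cong (λ c → (c + toℕ x) % suc m) (toℕ-fromℕ< (m%n<n r (suc m))) ⟩
    ((toℕ u + toℕ v + (suc m ∸ toℕ x)) % suc m + toℕ x) % suc m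
      ≡⟨ %-+ˡ r (toℕ x) ⟩
    (toℕ u + toℕ v + (suc m ∸ toℕ x) + toℕ x) % suc m
      ≡⟨ cong (_% suc m) (ℕ.+-assoc (toℕ u + toℕ v) _ _) ⟩
    (toℕ u + toℕ v + (suc m ∸ toℕ x + toℕ x)) % suc m
      ≡⟨ cong (λ c → (toℕ u + toℕ v + c) % suc m) (ℕ.m∸n+n≡m (ℕ.<⇒≤ (toℕ<n x))) ⟩
    (toℕ u + toℕ v + suc m) % suc m
      ≡⟨ [m+n]%n≡m%n (toℕ u + toℕ v) (suc m) ⟩
    (toℕ u + toℕ v) % suc m ∎
    where
    open ≡-Reasoning
    r = toℕ u + toℕ v + (suc m ∸ toℕ x)

  -- Cancelling x shows y and the reflection of x to be congruent, and both lie below the modulus.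
  -- Identities between reflections thus reduce to checking one sum.
  reflect-unique : ∀ u v (x y : Fin (suc m)) →
    (toℕ y + toℕ x) % suc m ≡ (toℕ u + toℕ v) % suc m → y ≡ reflect u v x
  reflect-unique u v x y eq = toℕ-injective (trans (sym (m<n⇒m%n≡m (toℕ<n y))) (trans
    (+-cancelʳ-% (toℕ y) (toℕ (reflect u v x)) x (trans eq (sym (reflect-sum u v x))))
    (m<n⇒m%n≡m (toℕ<n (reflect u v x)))))

reflect-left : ∀ {m} (u v : Fin m) → reflect u v u ≡ v
reflect-left {suc m} u v = sym (reflect-unique u v u v (cong (_% suc m) (ℕ.+-comm (toℕ v) (toℕ u))))

reflect-right : ∀ {m} (u v : Fin m) → reflect u v v ≡ u
reflect-right {suc m} u v = sym (reflect-unique u v v u refl)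

reflect-involutive : ∀ {m} (u v x : Fin m) → reflect u v (reflect u v x) ≡ x
reflect-involutive {suc m} u v x = sym (reflect-unique u v _ x
  (trans (cong (_% suc m) (ℕ.+-comm (toℕ x) (toℕ (reflect u v x)))) (reflect-sum u v x)))

-- This is (u + v - (x + 1)) + 1 = u + v - x; cancelling rotations gives both signs of
-- `reflect-rotate`.
rotate-reflect-next : ∀ {m} (u v x : Fin m) → rotate true (reflect u v (rotate true x)) ≡ reflect u v x
rotate-reflect-next {suc m} u v x = reflect-unique u v x (rotate true y) (begin
  (toℕ (shift 1 y) + toℕ x) % suc m         ≡⟨ cong (λ c → (c + toℕ x) % suc m) (toℕ-shift 1 y) ⟩
  ((toℕ y + 1) % suc m + toℕ x) % suc m     ≡⟨ %-+ˡ (toℕ y + 1) (toℕ x) ⟩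
  (toℕ y + 1 + toℕ x) % suc m
    ≡⟨ cong (_% suc m) (trans (ℕ.+-assoc (toℕ y) 1 (toℕ x))
         (trans (ℕ.+-comm (toℕ y) _) (cong (_+ toℕ y) (ℕ.+-comm 1 (toℕ x))))) ⟩
  (toℕ x + 1 + toℕ y) % suc m               ≡⟨ %-+ˡ (toℕ x + 1) (toℕ y) ⟨
  ((toℕ x + 1) % suc m + toℕ y) % suc m     ≡⟨ cong (λ c → (c + toℕ y) % suc m) (toℕ-shift 1 x) ⟨
  (toℕ (shift 1 x) + toℕ y) % suc m         ≡⟨ cong (_% suc m) (ℕ.+-comm (toℕ (shift 1 x)) (toℕ y)) ⟩
  (toℕ y + toℕ (shift 1 x)) % suc m         ≡⟨ reflect-sum u v (shift 1 x) ⟩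
  (toℕ u + toℕ v) % suc m                   ∎)
  where
  open ≡-Reasoning
  y = reflect u v (rotate true x)

reflect-rotate : ∀ {m} (u v : Fin m) s x →
  reflect u v (rotate s x) ≡ rotate (not s) (reflect u v x)
reflect-rotate u v true  x = trans (sym (rotate-cancel′ true _))
  (cong (rotate false) (rotate-reflect-next u v x))
reflect-rotate u v false x = trans (sym (rotate-reflect-next u v (rotate false x)))
  (cong (rotate true ∘ reflect u v) (rotate-cancel true x))

-- The torus and its automorphisms

Torus : ∀ {k} → (Fin k → ℕ) → Graph
Torus n = □-product (λ i → C (n i))

Point : ∀ {k} → (Fin k → ℕ) → Set
Point n = Graph.Vertex (Torus n)

coord : ∀ {k} (n : Fin k → ℕ) i → Point n → Fin (n i)
coord n zero    (x , _) = x
coord n (suc i) (_ , u) = coord (n ∘ suc) i u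

point : ∀ {k} (n : Fin k → ℕ) → (∀ i → Fin (n i)) → Point n
point {zero}  n f = tt
point {suc k} n f = f zero , point (n ∘ suc) (f ∘ suc)

coord-point : ∀ {k} (n : Fin k → ℕ) f i → coord n i (point n f) ≡ f i
coord-point n f zero    = refl
coord-point n f (suc i) = coord-point (n ∘ suc) (f ∘ suc) i

coord-ext : ∀ {k} (n : Fin k → ℕ) {u v} → (∀ i → coord n i u ≡ coord n i v) → u ≡ v
coord-ext {zero}  n eq = refl
coord-ext {suc k} n eq = cong₂ _,_ (eq zero) (coord-ext (n ∘ suc) (eq ∘ suc))

step : ∀ {k} (n : Fin k → ℕ) → Fin k → Bool → Point n → Point n
step n zero    s (x , u) = rotate s x , u
step n (suc i) s (x , u) = x , step (n ∘ suc) i s u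

coord-step : ∀ {k} (n : Fin k → ℕ) i s u → coord n i (step n i s u) ≡ rotate s (coord n i u)
coord-step n zero    s u       = refl
coord-step n (suc i) s (_ , u) = coord-step (n ∘ suc) i s u

coord-step-≢ : ∀ {k} (n : Fin k → ℕ) {i j} s u → i ≢ j → coord n j (step n i s u) ≡ coord n j u
coord-step-≢ n {zero}  {zero}  s u i≢j = contradiction refl i≢j
coord-step-≢ n {zero}  {suc j} s u i≢j = refl
coord-step-≢ n {suc i} {zero}  s u i≢j = refl
coord-step-≢ n {suc i} {suc j} s u i≢j = coord-step-≢ (n ∘ suc) s _ (i≢j ∘ cong suc)

adjacent⇒step : ∀ {k} (n : Fin k → ℕ) {u v} → Graph._~_ (Torus n) u v →
  ∃₂ λ i s → v ≡ step n i s u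
adjacent⇒step {suc k} n (inj₁ (refl , u~v)) with i , s , refl ← adjacent⇒step (n ∘ suc) u~v =
  suc i , s , refl
adjacent⇒step {suc k} n (inj₂ (x~y , refl)) with s , refl ← adjacent⇒rotate x~y =
  zero , s , refl

step-adjacent : ∀ {k} (n : Fin k → ℕ) → (∀ i → 5 ≤ n i) → ∀ i s u →
  Graph._~_ (Torus n) u (step n i s u)
step-adjacent n 5≤n zero    s (x , u) = inj₂ (rotate-adjacent (5≤n zero) s x , refl)
step-adjacent n 5≤n (suc i) s (x , u) = inj₁ (refl , step-adjacent (n ∘ suc) (5≤n ∘ suc) i s u)

-- Go from u to v one coordinate at a time: coordinates that agree need no move, and the others are
-- adjusted by forward steps, along which `g` is constant.
step-invariant : ∀ {k} (n : Fin k → ℕ) {A : Set} (g : Point n → A) u v →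
  (∀ i → coord n i u ≡ coord n i v ⊎ (∀ w → g (step n i true w) ≡ g w)) → g u ≡ g v
step-invariant {zero}  n g u v inv = refl
step-invariant {suc k} n g (x , u) (y , v) inv = trans
  (slide (inv zero))
  (step-invariant (n ∘ suc) (λ w → g (y , w)) u v λ i → rest (inv (suc i)))
  where
  folded : (∀ w → g (step n zero true w) ≡ g w) → ∀ a → g (fold x (rotate true) a , u) ≡ g (x , u)
  folded h zero    = refl
  folded h (suc a) = trans (h _) (folded h a)

  slide : x ≡ y ⊎ (∀ w → g (step n zero true w) ≡ g w) → g (x , u) ≡ g (y , u)
  slide (inj₁ refl) = refl
  slide (inj₂ h) with a , refl ← fold-rotate-transitive x y = sym (folded h a)

  rest : ∀ {i} →
    coord (n ∘ suc) i u ≡ coord (n ∘ suc) i v ⊎ (∀ w → g (step n (suc i) true w) ≡ g w) →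
    coord (n ∘ suc) i u ≡ coord (n ∘ suc) i v ⊎ (∀ w → g (y , step (n ∘ suc) i true w) ≡ g (y , w))
  rest (inj₁ eq) = inj₁ eq
  rest (inj₂ h)  = inj₂ (λ w → h (y , w))

-- Read the signs as ±1. If a were s, the equation would say 2s = b - s, where the right side is 0
-- for b = s and -2s otherwise; so 2 or 4 would vanish modulo m.
rotate-meet : ∀ {m} → 5 ≤ m → ∀ s a b (x : Fin m) →
  rotate a (rotate s x) ≡ rotate b (rotate (not s) x) → a ≡ not s
rotate-meet 5≤m s a b x eq with a ≟ᵇ s | b ≟ᵇ s
... | no a≢s   | _ = ¬-not a≢s
... | yes refl | yes refl = contradiction (trans eq (rotate-cancel a x)) (rotate²-moves 5≤m a x)
... | yes refl | no b≢s rewrite ¬-not b≢s = contradiction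
  (trans (cong (rotate a ∘ rotate a) eq)
    (trans (cong (rotate a) (rotate-cancel a _)) (rotate-cancel a x)))
  (rotate⁴-moves 5≤m a x)

module _ {k : ℕ} (n : Fin k → ℕ) where

  private π = coord n

  step-cancel : ∀ i s u → step n i s (step n i (not s) u) ≡ u
  step-cancel i s u = coord-ext n go
    where
    go : ∀ j → π j (step n i s (step n i (not s) u)) ≡ π j u
    go j with i Fin.≟ j
    ... | yes refl = trans (coord-step n i s _)
          (trans (cong (rotate s) (coord-step n i (not s) u)) (rotate-cancel s _))
    ... | no i≢j = trans (coord-step-≢ n s _ i≢j) (coord-step-≢ n (not s) u i≢j)

  step-cancel′ : ∀ i s u → step n i (not s) (step n i s u) ≡ u
  step-cancel′ i true  = step-cancel i false
  step-cancel′ i false = step-cancel i true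

  step-comm : ∀ i s j t u → i ≢ j → step n i s (step n j t u) ≡ step n j t (step n i s u)
  step-comm i s j t u i≢j = coord-ext n go
    where
    go : ∀ l → π l (step n i s (step n j t u)) ≡ π l (step n j t (step n i s u))
    go l with i Fin.≟ l | j Fin.≟ l
    ... | yes refl | yes refl = contradiction refl i≢j
    ... | yes refl | no j≢l = trans (coord-step n i s _) (trans (cong (rotate s) (coord-step-≢ n t u j≢l))
          (sym (trans (coord-step-≢ n t _ j≢l) (coord-step n i s u))))
    ... | no i≢l | yes refl = trans (coord-step-≢ n s _ i≢l) (trans (coord-step n j t u)
          (sym (trans (coord-step n j t _) (cong (rotate t) (coord-step-≢ n s u i≢l)))))
    ... | no i≢l | no j≢l = trans (coord-step-≢ n s _ i≢l) (trans (coord-step-≢ n t u j≢l)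
          (sym (trans (coord-step-≢ n t _ j≢l) (coord-step-≢ n s u i≢l))))

  coord-walk : ∀ i s u a → π i (fold u (step n i s) a) ≡ fold (π i u) (rotate s) a
  coord-walk i s u zero    = refl
  coord-walk i s u (suc a) = trans (coord-step n i s _) (cong (rotate s) (coord-walk i s u a))

  coord-walk-≢ : ∀ {i j} s u a → i ≢ j → π j (fold u (step n i s) a) ≡ π j u
  coord-walk-≢ s u zero    i≢j = refl
  coord-walk-≢ s u (suc a) i≢j = trans (coord-step-≢ n s _ i≢j) (coord-walk-≢ s u a i≢j)

  walk-order : ∀ i s u → fold u (step n i s) (n i) ≡ u
  walk-order i s u = coord-ext n go
    where
    go : ∀ j → π j (fold u (step n i s) (n i)) ≡ π j u
    go j with i Fin.≟ j
    ... | yes refl = trans (coord-walk i s u (n i)) (rotate-order s (π i u))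
    ... | no i≢j   = coord-walk-≢ s u (n i) i≢j

  walk-period : ∀ i s u {a} → 0 < a → fold u (step n i s) a ≡ u → n i ≤ a
  walk-period i s u {suc a} _ eq =
    rotate-period s (π i u) a (trans (sym (coord-walk i s u (suc a))) (cong (π i) eq))

to-injective : ∀ {G} (φ : Automorphism G) {u v} →
  Automorphism.to φ u ≡ Automorphism.to φ v → u ≡ v
to-injective φ {u} {v} eq = trans (sym (strictlyInverseʳ u)) (trans (cong from eq) (strictlyInverseʳ v))
  where
  open Automorphism φ using (perm; from)
  open Inverse perm using (strictlyInverseʳ)

-- Automorphisms map straight walks to straight walks

module _ {k : ℕ} (n : Fin k → ℕ) (5≤n : ∀ i → 5 ≤ n i) where

  private π = coord n
  open Graph (Torus n) using (_~_)

  step-moves : ∀ i s u → π i (step n i s u) ≢ π i u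
  step-moves i s u eq = rotate-moves (5≤n i) s (π i u) (trans (sym (coord-step n i s u)) eq)

  step-opposite : ∀ i s u → π i (step n i s u) ≢ π i (step n i (not s) u)
  step-opposite i s u eq = rotate-opposite (5≤n i) s (π i u)
    (trans (sym (coord-step n i s u)) (trans eq (coord-step n i (not s) u)))

  -- Let a and b be the directions of the steps from the two neighbours of u to w. If both are i,
  -- `rotate-meet` forces a step back to u. If only one is i, the coordinate in the other direction
  -- changes along just one of the two paths. If neither is i, the two neighbours would agree in
  -- coordinate i.
  unique-common-neighbour : ∀ i s u {w} →
    step n i s u ~ w → step n i (not s) u ~ w → w ≡ u
  unique-common-neighbour i s u p q
    with a , sa , refl ← adjacent⇒step n p | b , sb , eq ← adjacent⇒step n q
    with a Fin.≟ i | b Fin.≟ i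
  ... | yes refl | yes refl = trans
        (cong (λ t → step n i t (step n i s u)) (rotate-meet (5≤n i) s sa sb (π i u) (begin
          rotate sa (rotate s (π i u))        ≡⟨ coord-step² sa s ⟨
          π i (step n i sa (step n i s u))    ≡⟨ cong (π i) eq ⟩
          π i (step n i sb (step n i (not s) u)) ≡⟨ coord-step² sb (not s) ⟩
          rotate sb (rotate (not s) (π i u))  ∎)))
        (step-cancel′ n i s u)
    where
    open ≡-Reasoning
    coord-step² : ∀ t r → π i (step n i t (step n i r u)) ≡ rotate t (rotate r (π i u))
    coord-step² t r = trans (coord-step n i t _) (cong (rotate t) (coord-step n i r u))
  ... | yes refl | no b≢i = contradiction
        (trans (cong (π b) (sym eq)) (trans (coord-step-≢ n sa _ i≢b) (trans (coord-step-≢ n s u i≢b)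
          (sym (coord-step-≢ n (not s) u i≢b)))))
        (step-moves b sb _)
    where i≢b = b≢i ∘ sym
  ... | no a≢i | yes refl = contradiction
        (trans (cong (π a) eq) (trans (coord-step-≢ n sb _ i≢a) (trans (coord-step-≢ n (not s) u i≢a)
          (sym (coord-step-≢ n s u i≢a)))))
        (step-moves a sa _)
    where i≢a = a≢i ∘ sym
  ... | no a≢i | no b≢i = contradiction
        (trans (sym (coord-step-≢ n sa _ a≢i)) (trans (cong (π i) eq) (coord-step-≢ n sb _ b≢i)))
        (step-opposite i s u)

  module _ (φ : Automorphism (Torus n)) where
    open Automorphism φ
    open Inverse perm using () renaming (strictlyInverseˡ to to-from)

    step-image : ∀ i s u → ∃₂ λ j t → to (step n i s u) ≡ step n j t (to u)
    step-image i s u = adjacent⇒step n (preserves (step-adjacent n 5≤n i s u))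

    -- If φ turned the straight path u − eᵢ, u, u + eᵢ into a corner, that
    -- corner would lie in a 4-cycle, giving u ± eᵢ a second common neighbour.
    no-corner : ∀ {i s u j t j′ t′} → to (step n i s u) ≡ step n j t (to u) →
      to (step n i (not s) u) ≡ step n j′ t′ (to u) → j′ ≡ j
    no-corner {i} {s} {u} {j} {t} {j′} {t′} eq eq′ with j′ Fin.≟ j
    ... | yes j′≡j = j′≡j
    ... | no  j′≢j = contradiction
      (trans (sym (coord-step-≢ n t′ (step n j t (to u)) j′≢j)) (cong (π j) w≡u))
      (step-moves j t (to u))
      where
      w = step n j′ t′ (step n j t (to u))
      p : step n i s u ~ from w
      p = reflects (subst₂ _~_ (sym eq) (sym (to-from w)) (step-adjacent n 5≤n j′ t′ _))
      q : step n i (not s) u ~ from w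
      q = reflects (subst₂ _~_ (sym eq′)
            (trans (step-comm n j t j′ t′ (to u) (j′≢j ∘ sym)) (sym (to-from w)))
            (step-adjacent n 5≤n j t _))
      w≡u : w ≡ to u
      w≡u = trans (sym (to-from w)) (cong to (unique-common-neighbour i s u p q))

    -- By `no-corner` the opposite step also goes in direction j, and by injectivity its sign cannot
    -- be t again.
    straight : ∀ {i s u j t} → to (step n i s u) ≡ step n j t (to u) →
      to (step n i (not s) u) ≡ step n j (not t) (to u)
    straight {i} {s} {u} {j} {t} eq
      with j′ , t′ , eq′ ← step-image i (not s) u
      with refl ← no-corner eq eq′
      with t′ ≟ᵇ t
    ... | yes refl = contradiction (cong (π i) (to-injective φ (trans eq (sym eq′)))) (step-opposite i s u)
    ... | no t′≢t  = trans eq′ (cong (λ r → step n j r (to u)) (¬-not t′≢t))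

    straight-walk : ∀ {i s u j t} → to (step n i s u) ≡ step n j t (to u) →
      ∀ a → to (fold u (step n i s) a) ≡ fold (to u) (step n j t) a
    straight-walk {i} {s} {u} {j} {t} eq zero    = refl
    straight-walk {i} {s} {u} {j} {t} eq (suc a) = trans (next a) (cong (step n j t) (straight-walk eq a))
      where
      next : ∀ a → to (step n i s (fold u (step n i s) a)) ≡ step n j t (to (fold u (step n i s) a))
      next zero    = eq
      -- At the new vertex v the image of the step back is known from `next a`; `straight` turns it
      -- into the image of the step forward, with both signs negated twice.
      next (suc a) = subst₂ (λ r r′ → to (step n i r v) ≡ step n j r′ (to v))
        (not-involutive s) (not-involutive t) (straight back)
        where
        v = step n i s (fold u (step n i s) a)
        back : to (step n i (not s) v) ≡ step n j (not t) (to v)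
        back = trans (cong to (step-cancel′ n i s _))
          (trans (sym (step-cancel′ n j t _)) (cong (step n j (not t)) (sym (next a))))

    -- A straight walk in direction i first closes up after `n i` steps. As φ is injective, a walk
    -- closes up exactly when its image does, so each length bounds the other.
    step-image-order : ∀ {i s u j t} → to (step n i s u) ≡ step n j t (to u) → n i ≡ n j
    step-image-order {i} {s} {u} {j} {t} eq = ℕ.≤-antisym
      (walk-period n i s u (positive j)
        (to-injective φ (trans (straight-walk eq (n j)) (walk-order n j t (to u)))))
      (walk-period n j t (to u) (positive i)
        (trans (sym (straight-walk eq (n i))) (cong to (walk-order n i s u))))
      where
      positive : ∀ i → 0 < n i
      positive i = ℕ.≤-trans (s≤s z≤n) (5≤n i)

-- Distinct lengths: automorphisms act on each coordinate separately

module _ {k : ℕ} (n : Fin k → ℕ) (5≤n : ∀ i → 5 ≤ n i)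
         (distinct : ∀ i j → i ≢ j → n i ≢ n j) (φ : Automorphism (Torus n)) where
  private π = coord n
  open Automorphism φ

  direction-preserved : ∀ i s u → ∃ λ t → to (step n i s u) ≡ step n i t (to u)
  direction-preserved i s u with j , t , eq ← step-image n 5≤n φ i s u with i Fin.≟ j
  ... | yes refl = t , eq
  ... | no i≢j = contradiction (step-image-order n 5≤n φ eq) (distinct i j i≢j)

  -- Steps in directions other than i keep their direction under φ, so they do not affect coordinate
  -- i of the image; `step-invariant` then applies.
  coord-image : ∀ i {u v} → π i u ≡ π i v → π i (to u) ≡ π i (to v)
  coord-image i {u} {v} eq = step-invariant n (λ w → π i (to w)) u v inv
    where
    inv : ∀ j → π j u ≡ π j v ⊎ (∀ w → π i (to (step n j true w)) ≡ π i (to w))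
    inv j with j Fin.≟ i
    ... | yes refl = inj₁ eq
    ... | no j≢i = inj₂ λ w → let t , e = direction-preserved j true w in
            trans (cong (π i) e) (coord-step-≢ n t (to w) j≢i)

  -- The fixed values at v - eᵢ and v show that φ keeps the sign of the backward step at v; by
  -- `straight` it keeps that of the forward step too.
  fixes-next : ∀ i v → π i (to (step n i false v)) ≡ π i (step n i false v) →
    π i (to v) ≡ π i v → π i (to (step n i true v)) ≡ π i (step n i true v)
  fixes-next i v fixed⁻ fixed with t , eq ← direction-preserved i false v = begin
    π i (to (step n i true v))     ≡⟨ cong (π i) (straight n 5≤n φ eq) ⟩
    π i (step n i (not t) (to v))  ≡⟨ coord-step n i (not t) (to v) ⟩
    rotate (not t) (π i (to v))    ≡⟨ cong₂ (rotate ∘ not) t≡false fixed ⟩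
    rotate true (π i v)            ≡⟨ coord-step n i true v ⟨
    π i (step n i true v)          ∎
    where
    open ≡-Reasoning
    backwards : rotate t (π i v) ≡ rotate false (π i v)
    backwards = begin
      rotate t (π i v)             ≡⟨ cong (rotate t) fixed ⟨
      rotate t (π i (to v))        ≡⟨ coord-step n i t (to v) ⟨
      π i (step n i t (to v))      ≡⟨ cong (π i) eq ⟨
      π i (to (step n i false v))  ≡⟨ fixed⁻ ⟩
      π i (step n i false v)       ≡⟨ coord-step n i false v ⟩
      rotate false (π i v)         ∎
    t≡false : t ≡ false
    t≡false with t ≟ᵇ false
    ... | yes t≡false = t≡false
    ... | no  t≢false = contradiction
      (subst (λ r → rotate r (π i v) ≡ rotate false (π i v)) (¬-not t≢false) backwards)
      (rotate-opposite (5≤n i) true (π i v))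

  -- The vertices p and q give two consecutive fixed values of coordinate i, and `fixes-next`
  -- propagates them around the cycle. By `coord-image` only coordinate i matters, so q need not lie
  -- on the walk from p, nor u.
  fixes-coord : ∀ i {p q} → to p ≡ p → to q ≡ q → π i q ≡ rotate true (π i p) →
    ∀ u → π i (to u) ≡ π i u
  fixes-coord i {p} {q} fp fq succ u with a , eq ← fold-rotate-transitive (π i p) (π i u) =
    trans (coord-image i u≡) (trans (fixed a) (sym u≡))
    where
    walk : ℕ → Point n
    walk = fold p (step n i true)

    u≡ : π i u ≡ π i (walk a)
    u≡ = trans eq (sym (coord-walk n i true p a))

    fixed : ∀ a → π i (to (walk a)) ≡ π i (walk a)
    fixed zero          = cong (π i) fp
    fixed (suc zero)    = trans (coord-image i (sym q≡)) (trans (cong (π i) fq) q≡)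
      where q≡ = trans succ (sym (coord-step n i true p))
    fixed (suc (suc a)) = fixes-next i (walk (suc a))
      (subst (λ w → π i (to w) ≡ π i w) (sym (step-cancel n i false (walk a))) (fixed a))
      (fixed (suc a))

  -- The witnesses may vary with i and need not be adjacent, so that a few fixed vertices can serve
  -- all directions.
  rigid : (∀ i → ∃₂ λ p q → to p ≡ p × to q ≡ q × π i q ≡ rotate true (π i p)) →
    IsIdentity φ
  rigid h u = coord-ext n λ i → let p , q , fp , fq , succ = h i in fixes-coord i fp fq succ u

-- Reflections of the torus

module _ {k : ℕ} (n : Fin k → ℕ) (u v : Point n) where

  private π = coord n

  reflectPoint : Point n → Point n
  reflectPoint w = point n λ i → reflect (π i u) (π i v) (π i w)

  coord-reflectPoint : ∀ i w → π i (reflectPoint w) ≡ reflect (π i u) (π i v) (π i w)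
  coord-reflectPoint i w = coord-point n _ i

  reflectPoint-involutive : ∀ w → reflectPoint (reflectPoint w) ≡ w
  reflectPoint-involutive w = coord-ext n λ i → trans (coord-reflectPoint i _)
    (trans (cong (reflect (π i u) (π i v)) (coord-reflectPoint i w)) (reflect-involutive _ _ _))

  reflectPoint-left : reflectPoint u ≡ v
  reflectPoint-left = coord-ext n λ i → trans (coord-reflectPoint i u) (reflect-left _ _)

  reflectPoint-right : reflectPoint v ≡ u
  reflectPoint-right = coord-ext n λ i → trans (coord-reflectPoint i v) (reflect-right _ _)

  reflectPoint-step : ∀ i s w → reflectPoint (step n i s w) ≡ step n i (not s) (reflectPoint w)
  reflectPoint-step i s w = coord-ext n go
    where
    go : ∀ j → π j (reflectPoint (step n i s w)) ≡ π j (step n i (not s) (reflectPoint w))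
    go j with i Fin.≟ j
    ... | yes refl = trans (coord-reflectPoint i _)
          (trans (cong (reflect (π i u) (π i v)) (coord-step n i s w))
          (trans (reflect-rotate (π i u) (π i v) s (π i w)) (sym (trans (coord-step n i (not s) _)
          (cong (rotate (not s)) (coord-reflectPoint i w))))))
    ... | no i≢j = trans (coord-reflectPoint j _)
          (trans (cong (reflect (π j u) (π j v)) (coord-step-≢ n s w i≢j))
          (sym (trans (coord-step-≢ n (not s) _ i≢j) (coord-reflectPoint j w))))

  module _ (5≤n : ∀ i → 5 ≤ n i) where

    open Graph (Torus n) using (_~_)

    reflectPoint-preserves : ∀ {x y} → x ~ y → reflectPoint x ~ reflectPoint y
    reflectPoint-preserves {x} x~y with i , s , refl ← adjacent⇒step n x~y =
      subst (reflectPoint x ~_) (sym (reflectPoint-step i s x)) (step-adjacent n 5≤n i (not s) _)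

    reflection : Automorphism (Torus n)
    reflection = record
      { perm = mk↔ₛ′ reflectPoint reflectPoint reflectPoint-involutive reflectPoint-involutive
      ; preserves = reflectPoint-preserves
      ; reflects  = λ {x} {y} p →
          subst₂ _~_ (reflectPoint-involutive x) (reflectPoint-involutive y) (reflectPoint-preserves p)
      }

    -- If u were fixed, u + eᵢ would be sent to u - eᵢ, a different vertex. This argument also
    -- covers u = v, where swapping u and v moves nothing.
    reflection-nontrivial : Fin k → ¬ IsIdentity reflection
    reflection-nontrivial i trivial = step-opposite n 5≤n i true u (cong (π i)
      (trans (sym (trivial (step n i true u)))
        (trans (reflectPoint-step i true u) (cong (step n i false) (trivial u)))))

-- Sizes of color classes

module _ (S : Setoid 0ℓ 0ℓ) where
  open Setoid S renaming (refl to ≈-refl; sym to ≈-sym; trans to ≈-trans)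
  open Membership S using (_∈_)
  open import Relation.Binary.Properties.Setoid S using (≉-respʳ)

  lookup-injective : ∀ {xs} → Unique S xs → ∀ i j → List.lookup xs i ≈ List.lookup xs j → i ≡ j
  lookup-injective (_   ∷ _)   zero    zero    _   = refl
  lookup-injective (x∉xs ∷ _)  zero    (suc j) x≈y =
    contradiction x≈y (All.lookupₛ S ≉-respʳ x∉xs (∈-lookup S _ j))
  lookup-injective (x∉xs ∷ _)  (suc i) zero    y≈x =
    contradiction (≈-sym y≈x) (All.lookupₛ S ≉-respʳ x∉xs (∈-lookup S _ i))
  lookup-injective (_ ∷ xs!)   (suc i) (suc j) x≈y = cong suc (lookup-injective xs! i j x≈y)

  -- The bijection is the position in the list; uniqueness up to ≈ makes it independent of the
  -- representative and of the proof of `P`.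
  subset-hasSize : ∀ {P : Carrier → Set} xs → Unique S xs → P ⊆ (_∈ xs) → (_∈ xs) ⊆ P →
    HasSize (On.setoid {B = ∃ P} S proj₁) (length xs)
  subset-hasSize {P} xs xs! P⊆xs xs⊆P = record
    { to        = position
    ; from      = λ i → List.lookup xs i , xs⊆P (∈-lookup S xs i)
    ; to-cong   = λ {a} {b} a≈b → injective (≈-trans (≈-sym (located a)) (≈-trans a≈b (located b)))
    ; from-cong = λ { refl → ≈-refl }
    ; inverse   = (λ {i} {a} a≈ → injective (≈-trans (≈-sym (located a)) a≈))
                , (λ { {a} refl → ≈-sym (located a) })
    }
    where
    position : ∃ P → Fin (length xs)
    position (x , Px) = index (P⊆xs Px)
    located : ∀ a → proj₁ a ≈ List.lookup xs (position a)
    located (x , Px) = lookup-index (P⊆xs Px)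
    injective : ∀ {i j} → List.lookup xs i ≈ List.lookup xs j → i ≡ j
    injective = lookup-injective xs! _ _

Fin2-≢ : ∀ {x y j : Fin 2} → x ≢ j → y ≢ j → x ≡ y
Fin2-≢ {zero}     {zero}     _   _   = refl
Fin2-≢ {suc zero} {suc zero} _   _   = refl
Fin2-≢ {zero}     {suc zero} {zero}     x≢j _ = contradiction refl x≢j
Fin2-≢ {zero}     {suc zero} {suc zero} _ y≢j = contradiction refl y≢j
Fin2-≢ {suc zero} {zero}     {zero}     _ y≢j = contradiction refl y≢j
Fin2-≢ {suc zero} {zero}     {suc zero} x≢j _ = contradiction refl x≢j

module _ (G : Graph) (X : DecSetoid 0ℓ 0ℓ) where
  open DecSetoid X using (Carrier; setoid; _≈_) renaming (_≟_ to _≈?_; sym to ≈-sym)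
  open DecMembership X using (_∈_; _∈?_)

  module _ (act : Automorphism G → Carrier → Carrier) where
    open Distinguish G setoid act

    -- An involution mapping one class into itself does so for the other class: a point outside
    -- whose image lies inside would itself be the image of a point inside.
    two-coloring-preserved : ∀ φ (c : Coloring 2) j →
      (∀ x → act φ (act φ x) ≈ x) →
      (∀ x → Func.to c x ≡ j → Func.to c (act φ x) ≡ j) → Preserves φ c
    two-coloring-preserved φ c j involutive closed x
      with Func.to c x Fin.≟ j | Func.to c (act φ x) Fin.≟ j
    ... | yes x∈j | _ = trans (closed x x∈j) (sym x∈j)
    ... | no  x∉j | no  φx∉j = Fin2-≢ φx∉j x∉j
    ... | no  x∉j | yes φx∈j =
      contradiction (trans (sym (Func.cong c (involutive x))) (closed (act φ x) φx∈j)) x∉j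

    marking : List Carrier → Coloring 2
    marking ms = record { to = color ; cong = color-cong }
      where
      color : Carrier → Fin 2
      color x with x ∈? ms
      ... | yes _ = suc zero
      ... | no  _ = zero
      color-cong : ∀ {x y} → x ≈ y → color x ≡ color y
      color-cong {x} {y} x≈y with x ∈? ms | y ∈? ms
      ... | yes _ | yes _ = refl
      ... | no  _ | no  _ = refl
      ... | yes x∈ms | no y∉ms = contradiction (∈-resp-≈ setoid x≈y x∈ms) y∉ms
      ... | no x∉ms | yes y∈ms = contradiction (∈-resp-≈ setoid (≈-sym x≈y) y∈ms) x∉ms

    marked⇒∈ : ∀ ms {x} → Func.to (marking ms) x ≡ suc zero → x ∈ ms
    marked⇒∈ ms {x} _ with x ∈? ms
    ... | yes x∈ms = x∈ms

    ∈⇒marked : ∀ ms {x} → x ∈ ms → Func.to (marking ms) x ≡ suc zero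
    ∈⇒marked ms {x} x∈ms with x ∈? ms
    ... | yes _    = refl
    ... | no  x∉ms = contradiction x∈ms x∉ms

    preserves-marked : ∀ ms {φ} → Preserves φ (marking ms) → ∀ {x} → x ∈ ms → act φ x ∈ ms
    preserves-marked ms pres {x} x∈ms = marked⇒∈ ms (trans (pres x) (∈⇒marked ms x∈ms))

    -- The unmarked class has some size b ≥ length ms by the lower bound,
    -- so it is never the smaller one.
    cost : ∀ {xs} → IsEnumeration setoid xs → Carrier →
      (∃ λ φ → ¬ IsIdentity φ) →
      ∀ ms → Unique setoid ms → Distinguishing (marking ms) →
      (∀ (c : Coloring 2) j a → Distinguishing c → HasSize (colorClass c j) a → length ms ≤ a) →
      Cost≡ (length ms)
    cost {xs} enum x₀ (φ , φ≢id) ms ms! dist lower =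
      ((c , dist) , at-least-two) ,
      ((c , dist , _ , length ms , unmarked , marked ,
        sym (ℕ.m≥n⇒m⊓n≡n (lower c zero _ dist unmarked))) ,
       λ { _ (c′ , dist′ , a , b , size₀ , size₁ , refl) →
             ℕ.⊓-glb (lower c′ zero a dist′ size₀) (lower c′ (suc zero) b dist′ size₁) })
      where
      c = marking ms

      at-least-two : ∀ d → (∃ λ (c : Coloring d) → Distinguishing c) → 2 ≤ d
      -- Without colors `x₀` cannot be colored, and a single color is preserved by the nontrivial φ.
      at-least-two zero (c , _) with () ← Func.to c x₀
      at-least-two (suc zero) (c , d) = contradiction
        (d φ λ x → constant (Func.to c (act φ x)) (Func.to c x)) φ≢id
        where
        constant : (i j : Fin 1) → i ≡ j
        constant zero zero = refl
      at-least-two (suc (suc d)) _ = s≤s (s≤s z≤n)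

      marked : HasSize (colorClass c (suc zero)) (length ms)
      marked = subset-hasSize setoid ms ms! (marked⇒∈ ms) (∈⇒marked ms)

      unmarked? = λ x → Func.to c x Fin.≟ zero
      respects = λ {x} {y} x≈y p → trans (sym (Func.cong c {x} {y} x≈y)) p

      -- An enumeration may repeat elements, so duplicates are removed before the class is counted.
      unmarked : HasSize (colorClass c zero) (length (filter unmarked? (deduplicate _≈?_ xs)))
      unmarked = subset-hasSize setoid _ (filter⁺ setoid unmarked? (deduplicate-! X xs))
        (∈-filter⁺ setoid unmarked? respects (deduplicate⁺ X enum _))
        (λ {x} x∈ → proj₂ (∈-filter⁻ setoid unmarked? respects {xs = deduplicate _≈?_ xs} x∈))

-- Enumerations of vertices and edges

module _ (G : Graph) where
  open Graph G

  vertexDecSetoid : DecSetoid 0ℓ 0ℓ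
  vertexDecSetoid = record
    { isDecEquivalence = record { isEquivalence = Setoid.isEquivalence (vertexSetoid G) ; _≟_ = _≟_ } }

  edgeDecSetoid : DecSetoid 0ℓ 0ℓ
  edgeDecSetoid = record
    { isDecEquivalence = record
      { isEquivalence = Setoid.isEquivalence (edgeSetoid G)
      ; _≟_ = λ (u , v , _) (u′ , v′ , _) →
          ((u ≟ u′) ×-dec (v ≟ v′)) ⊎-dec ((u ≟ v′) ×-dec (v ≟ u′))
      } }

  allVertices : List Vertex
  allVertices = tabulate (Inverse.from vertices)

  allVertices-enumerates : IsEnumeration (vertexSetoid G) allVertices
  allVertices-enumerates v = subst (λ w → Any (w ≡_) allVertices)
    (Inverse.strictlyInverseʳ vertices v) (∈-tabulate⁺ {f = Inverse.from vertices} (Inverse.to vertices v))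

  edge? : Vertex × Vertex → Maybe (Setoid.Carrier (edgeSetoid G))
  edge? (u , v) with u ~? v
  ... | yes u~v = just (u , v , u~v)
  ... | no  _   = nothing

  edge?-finds : ∀ ((u , v , u~v) : Setoid.Carrier (edgeSetoid G)) →
    Maybe.Any (Setoid._≈_ (edgeSetoid G) (u , v , u~v)) (edge? (u , v))
  edge?-finds (u , v , u~v) with u ~? v
  ... | yes _   = Maybe.just (inj₁ (refl , refl))
  ... | no  u≁v = contradiction u~v u≁v

  -- Each edge is listed once for each order of its ends, hence twice.
  allEdges : List (Setoid.Carrier (edgeSetoid G))
  allEdges = mapMaybe edge? (cartesianProduct allVertices allVertices)

  allEdges-enumerates : IsEnumeration (edgeSetoid G) allEdges
  allEdges-enumerates e@(u , v , _) = mapMaybe⁺ edge? _ (map⁺ (Any.map (λ { refl → edge?-finds e })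
    (∈-cartesianProduct⁺ (allVertices-enumerates u) (allVertices-enumerates v))))

-- Colorings of the torus

module _ {k : ℕ} (n : Fin (suc k) → ℕ) (5≤n : ∀ i → 5 ≤ n i) where

  private
    G = Torus n
    module V = Distinguish G (vertexSetoid G) actV
    module E = Distinguish G (edgeSetoid G) actE
    open Setoid (edgeSetoid G) using () renaming (_≈_ to _≈ᴱ_)

  origin : Point n
  origin = point n λ i → fromℕ< (ℕ.≤-trans (s≤s z≤n) (5≤n i))

  -- The class is contained in {u, v}, and each alternative also records the color of the other
  -- point because that point is the image of x.
  reflection-preserves : ∀ (c : V.Coloring 2) {j} u v →
    (∀ x → Func.to c x ≡ j → x ≡ u × Func.to c v ≡ j ⊎ x ≡ v × Func.to c u ≡ j) →
    V.Preserves (reflection n u v 5≤n) c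
  reflection-preserves c {j} u v class = two-coloring-preserved G (vertexDecSetoid G) actV
    (reflection n u v 5≤n) c j (reflectPoint-involutive n u v) closed
    where
    closed : ∀ x → Func.to c x ≡ j → Func.to c (reflectPoint n u v x) ≡ j
    closed x x∈j with class x x∈j
    ... | inj₁ (refl , v∈j) = trans (cong (Func.to c) (reflectPoint-left n u v)) v∈j
    ... | inj₂ (refl , u∈j) = trans (cong (Func.to c) (reflectPoint-right n u v)) u∈j

  -- Sizes 0, 1 and 2 in turn: for an empty class any u and v will do, here the origin twice, and a
  -- singleton gives u = v.
  class-pair : ∀ (c : V.Coloring 2) {j a} → HasSize (V.colorClass c j) a → a ≤ 2 →
    ∃₂ λ u v → ∀ x → Func.to c x ≡ j → x ≡ u × Func.to c v ≡ j ⊎ x ≡ v × Func.to c u ≡ j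
  class-pair c {j} size z≤n = origin , origin , λ x x∈j → contradiction (Inverse.to size (x , x∈j)) λ ()
  class-pair c {j} size (s≤s z≤n) = u , u , λ x x∈j → inj₁ (x≡u x x∈j , u∈j)
    where
    open Inverse size
    u = proj₁ (from zero)
    u∈j = proj₂ (from zero)
    x≡u : ∀ x → Func.to c x ≡ j → x ≡ u
    x≡u x x∈j with to (x , x∈j) in eq
    ... | zero = sym (inverseʳ (sym eq))
  class-pair c {j} size (s≤s (s≤s z≤n)) = proj₁ (from zero) , proj₁ (from (suc zero)) , x∈uv
    where
    open Inverse size
    x∈uv : ∀ x → Func.to c x ≡ j → _ ⊎ _
    x∈uv x x∈j with to (x , x∈j) in eq
    ... | zero     = inj₁ (sym (inverseʳ (sym eq)) , proj₂ (from (suc zero)))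
    ... | suc zero = inj₂ (sym (inverseʳ (sym eq)) , proj₂ (from zero))

  vertexClass-size : ∀ (c : V.Coloring 2) j a → V.Distinguishing c → HasSize (V.colorClass c j) a → 3 ≤ a
  vertexClass-size c j a dist size = ℕ.≰⇒> λ a≤2 →
    let u , v , class = class-pair c size a≤2 in
    reflection-nontrivial n u v 5≤n zero
      (dist (reflection n u v 5≤n) (reflection-preserves c u v class))

  edge : ∀ i u → Setoid.Carrier (edgeSetoid G)
  edge i u = u , step n i true u , step-adjacent n 5≤n i true u

  class-edge : ∀ (c : E.Coloring 2) {j a} → HasSize (E.colorClass c j) a → a ≤ 1 →
    ∃ λ e → ∀ x → Func.to c x ≡ j → x ≈ᴱ e
  class-edge c {j} size z≤n = edge zero origin , λ x x∈j → contradiction (Inverse.to size (x , x∈j)) λ ()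
  class-edge c {j} size (s≤s z≤n) = proj₁ (from zero) , x≈e
    where
    open Inverse size
    x≈e : ∀ x → Func.to c x ≡ j → x ≈ᴱ (proj₁ (from zero))
    x≈e x x∈j with to (x , x∈j) in eq
    ... | zero = Setoid.sym (edgeSetoid G) {proj₁ (from zero)} {x} (inverseʳ (sym eq))

  -- Exchanging the ends of an edge maps it to itself as an unordered pair, so the reflection
  -- preserves a class containing at most that edge.
  edgeClass-size : ∀ (c : E.Coloring 2) j a → E.Distinguishing c → HasSize (E.colorClass c j) a → 2 ≤ a
  edgeClass-size c j a dist size = ℕ.≰⇒> λ a≤1 →
    let (u , v , u~v) , class = class-edge c size a≤1
        φ = reflection n u v 5≤n

        u↦v = reflectPoint-left n u v
        v↦u = reflectPoint-right n u v

        swapped : ∀ x → x ≈ᴱ (u , v , u~v) → actE φ x ≈ᴱ x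
        swapped = λ { (_ , _ , _) (inj₁ (refl , refl)) → inj₂ (u↦v , v↦u)
                    ; (_ , _ , _) (inj₂ (refl , refl)) → inj₂ (v↦u , u↦v) }
    in reflection-nontrivial n u v 5≤n zero (dist φ
      (two-coloring-preserved G (edgeDecSetoid G) actE φ c j
        (λ (x , y , _) →
          inj₁ (reflectPoint-involutive n u v x , reflectPoint-involutive n u v y))
        (λ x x∈j → trans (Func.cong c {actE φ x} {x} (swapped x (class x x∈j))) x∈j)))

-- Distinguishing colorings of least cost

module _ {k : ℕ} (n : Fin (suc (suc k)) → ℕ) (5≤n : ∀ i → 5 ≤ n i)
         (distinct : ∀ i j → i ≢ j → n i ≢ n j) where

  private
    G = Torus n
    π = coord n
    module V = Distinguish G (vertexSetoid G) actV
    module E = Distinguish G (edgeSetoid G) actE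
    open Membership (vertexSetoid G) using (_∈_)
    open Membership (edgeSetoid G) using () renaming (_∈_ to _∈ᴱ_)

    -- a = 0, b = e₁, c = e₀ + e₂ + e₃ + ⋯ and d = e₂ + e₃ + ⋯.
    a b c d a+e₀ d+e₁ : Point n
    a = origin n 5≤n
    b = step n (suc zero) true a
    d = point n dᵢ
      where
      dᵢ : ∀ i → Fin (n i)
      dᵢ zero          = π zero a
      dᵢ (suc zero)    = π (suc zero) a
      dᵢ (suc (suc i)) = rotate true (π (suc (suc i)) a)
    c = step n zero true d
    a+e₀ = step n zero true a
    d+e₁ = step n (suc zero) true d

  -- From a to c every coordinate but coordinate 1 advances by one, and b supplies coordinate 1;
  -- fixing the three points is therefore enough for `rigid`.
  vertexMarks : List (Point n)
  vertexMarks = a ∷ b ∷ c ∷ []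

  -- From a to d + e₁ every coordinate but coordinate 0 advances by one, and the first edge supplies
  -- coordinate 0.
  edgeMarks : List (Setoid.Carrier (edgeSetoid G))
  edgeMarks = edge n 5≤n zero a ∷ edge n 5≤n (suc zero) d ∷ []

  private
    moved : ∀ i x → π i (step n i true x) ≢ π i x
    moved i = step-moves n 5≤n i true

    coord-d : ∀ i → π (suc (suc i)) d ≡ rotate true (π (suc (suc i)) a)
    coord-d = coord-point (λ i → n (suc (suc i))) (λ i → rotate true (π (suc (suc i)) a))

    c₀≢a₀ : π zero c ≢ π zero a
    c₀≢a₀ = moved zero a
    b₁≢a₁ : π (suc zero) b ≢ π (suc zero) a
    b₁≢a₁ = moved (suc zero) a
    a≢b : a ≢ b
    a≢b a≡b = b₁≢a₁ (cong (π (suc zero)) (sym a≡b))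
    a≢c : a ≢ c
    a≢c a≡c = c₀≢a₀ (cong (π zero) (sym a≡c))
    b≢c : b ≢ c
    b≢c b≡c = c₀≢a₀ (cong (π zero) (sym b≡c))

  module _ (φ : Automorphism G) where
    open Automorphism φ

    private
      agree : ∀ i {x y p q} → to x ≡ p → to y ≡ q → π i x ≡ π i y → π i p ≡ π i q
      agree i refl refl = coord-image n 5≤n distinct φ i

      injective = to-injective φ

    -- Agreement in a coordinate survives φ. Among the three points only a and b agree in coordinate
    -- 0, and only a and c in coordinate 1, so both pairs are mapped to themselves and their common
    -- point a is fixed, hence b and c too.
    fixes-vertexMarks : (∀ {x} → x ∈ vertexMarks → to x ∈ vertexMarks) →
      to a ≡ a × to b ≡ b × to c ≡ c
    fixes-vertexMarks closed
      with closed (here refl) | closed (there (here refl)) | closed (there (there (here refl)))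
    ... | here fa | there (here fb) | there (there (here fc)) = fa , fb , fc
    ... | here fa | here fb | _ = contradiction (injective (trans fa (sym fb))) a≢b
    ... | here fa | there (there (here fb)) | _ = contradiction (agree zero fb fa refl) c₀≢a₀
    ... | here fa | _ | here fc = contradiction (injective (trans fa (sym fc))) a≢c
    ... | here fa | there (here fb) | there (here fc) = contradiction (injective (trans fb (sym fc))) b≢c
    ... | there (here fa) | _ | here fc = contradiction (agree (suc zero) fa fc refl) b₁≢a₁
    ... | there (here fa) | _ | there (here fc) = contradiction (injective (trans fa (sym fc))) a≢c
    ... | there (here fa) | _ | there (there (here fc)) = contradiction (agree (suc zero) fa fc refl) b₁≢a₁
    ... | there (there (here fa)) | here fb | _ = contradiction (agree zero fa fb refl) c₀≢a₀
    ... | there (there (here fa)) | there (here fb) | _ = contradiction (agree zero fa fb refl) c₀≢a₀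
    ... | there (there (here fa)) | there (there (here fb)) | _ =
          contradiction (injective (trans fa (sym fb))) a≢b

    -- The ends of the first edge agree in coordinate 1 and those of the second in coordinate 0, but
    -- not conversely, so neither edge is mapped to the other. As a and d agree in both coordinates,
    -- so do their images up to agreement in 0 and 1: flipping the first edge would change
    -- coordinate 0 for a but not for d, and flipping only the second would change coordinate 1 for
    -- d but not for a.
    fixes-edgeMarks : (∀ {x} → x ∈ᴱ edgeMarks → actE φ x ∈ᴱ edgeMarks) →
      to a ≡ a × to a+e₀ ≡ a+e₀ × to d+e₁ ≡ d+e₁
    fixes-edgeMarks closed
      with closed {edge n 5≤n zero a} (here (inj₁ (refl , refl)))
         | closed {edge n 5≤n (suc zero) d} (there (here (inj₁ (refl , refl))))
    ... | there (here (inj₁ (fa , fa′))) | _ = contradiction (agree (suc zero) fa′ fa refl) b₁≢a₁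
    ... | there (here (inj₂ (fa , fa′))) | _ = contradiction (agree (suc zero) fa fa′ refl) b₁≢a₁
    ... | here _ | here (inj₁ (fd , fd′)) = contradiction (agree zero fd′ fd refl) c₀≢a₀
    ... | here _ | here (inj₂ (fd , fd′)) = contradiction (agree zero fd fd′ refl) c₀≢a₀
    ... | here (inj₂ (fa , _)) | there (here (inj₁ (fd , _))) =
          contradiction (agree zero fa fd refl) c₀≢a₀
    ... | here (inj₂ (fa , _)) | there (here (inj₂ (fd , _))) =
          contradiction (agree zero fa fd refl) c₀≢a₀
    ... | here (inj₁ (fa , _)) | there (here (inj₂ (fd , _))) =
          contradiction (agree (suc zero) fd fa refl) b₁≢a₁
    ... | here (inj₁ (fa , fa′)) | there (here (inj₁ (_ , fd′))) = fa , fa′ , fd′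

  vertexMarks-distinguish : V.Distinguishing (marking G (vertexDecSetoid G) actV vertexMarks)
  vertexMarks-distinguish φ pres
    with fa , fb , fc ← fixes-vertexMarks φ
      (preserves-marked G (vertexDecSetoid G) actV vertexMarks {φ} pres) =
    rigid n 5≤n distinct φ λ where
      zero          → a , c , fa , fc , refl
      (suc zero)    → a , b , fa , fb , refl
      (suc (suc i)) → a , c , fa , fc , coord-d i

  edgeMarks-distinguish : E.Distinguishing (marking G (edgeDecSetoid G) actE edgeMarks)
  edgeMarks-distinguish φ pres
    with fa , fa′ , fd′ ← fixes-edgeMarks φ
      (λ {e} → preserves-marked G (edgeDecSetoid G) actE edgeMarks {φ} pres {e}) =
    rigid n 5≤n distinct φ λ where
      zero          → a , a+e₀ , fa , fa′ , refl
      (suc zero)    → a , d+e₁ , fa , fd′ , refl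
      (suc (suc i)) → a , d+e₁ , fa , fd′ , coord-d i

  private
    nontrivial : ∃ λ (φ : Automorphism G) → ¬ IsIdentity φ
    -- With a = 0 this is the automorphism x ↦ -x.
    nontrivial = reflection n a a 5≤n , reflection-nontrivial n a a 5≤n zero

  vertexCost : V.Cost≡ 3
  vertexCost = cost G (vertexDecSetoid G) actV (allVertices-enumerates G) a nontrivial
    vertexMarks ((a≢b ∷ a≢c ∷ []) ∷ (b≢c ∷ []) ∷ [] ∷ []) vertexMarks-distinguish
    (vertexClass-size n 5≤n)

  edgeCost : E.Cost≡ 2
  edgeCost = cost G (edgeDecSetoid G) actE (allEdges-enumerates G) (edge n 5≤n zero a) nontrivial
    edgeMarks ((distinctEdges ∷ []) ∷ [] ∷ []) edgeMarks-distinguish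
    (edgeClass-size n 5≤n)
    where
    distinctEdges : ¬ Setoid._≈_ (edgeSetoid G) (edge n 5≤n zero a) (edge n 5≤n (suc zero) d)
    distinctEdges (inj₁ (a≡d , a′≡d′)) = c₀≢a₀ (cong (π zero) a′≡d′)
    distinctEdges (inj₂ (a≡d′ , a′≡d)) = c₀≢a₀ (cong (π zero) a′≡d)

theorem5p4 : (k : ℕ) → 2 ≤ k → (n : Fin k → ℕ) →
    (∀ i j → i ≢ j → n i ≢ n j) → (∀ i → 5 ≤ n i) →
    let G = □-product (λ i → C (n i)) in
    ρ′≡ G 2 × ρ≡ G 3
theorem5p4 (suc (suc k)) (s≤s (s≤s z≤n)) n distinct 5≤n =
  edgeCost n 5≤n distinct , vertexCost n 5≤n distinct
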